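{- For any infinite binary information system $U$ and any $n\in\mathbb{N}$, \[L_U^{la}(n)=L_U^{ld}(n).\]
   Context: $\mathbb{N}=\{1,2,\ldots\}$. An infinite binary information system is a pair $U=(A,F)$ where $A$ is an infinite set (of objects) and $F$ is an infinite set of functions $A\to\{0,1\}$ (attributes). A problem over $U$ is a tuple $z=(\nu,f_1,\ldots,f_n)$ with $n\in\mathbb{N}$, $\nu:\{0,1\}^n\to\mathbb{N}$ and $f_1,\ldots,f_n\in F$ (not necessarily distinct); $z(a)=\nu(f_1(a),\ldots,f_n(a))$ for $a\in A$, and $\dim z=n$. Decision trees. A decision tree over $U$ is a finite directed rooted tree in which the root and the edges leaving the root are unlabeled, each terminal node is labeled with a number from $\mathbb{N}$, each working node (neither the root nor terminal) is labeled with an attribute from $F$, and each edge leaving a working node is labeled with a number from $\{0,1\}$ (the root is not terminal; several edges leaving the same working node may carry the same label). It is deterministic if exactly one edge leaves the root and edges leaving any working node have different labels. A complete path $\xi$ is a directed path from the root to a terminal node; $A(\xi)$ is the set of all $a\in A$ such that, for each working node of $\xi$, labeled with attribute $f$ and followed in $\xi$ by an edge labeled $\delta$, one has $f(a)=\delta$ ($A(\xi)=A$ if $\xi$ has no working nodes). $L(\Gamma)$ is the number of all nodes of $\Gamma$, including the root. $\Gamma$ is a decision tree over the problem $z=(\nu,f_1,\ldots,f_n)$ if all its working nodes are labeled with attributes from $\{f_1,\ldots,f_n\}$. A decision tree $\Gamma$ over $z$ solves $z$ nondeterministically if for every $a\in A$ there is a complete path $\xi$ with $a\in A(\xi)$,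 and for every $a\in A$ and every complete path $\xi$ with $a\in A(\xi)$ the terminal node of $\xi$ is labeled $z(a)$. It solves $z$ deterministically if, in addition, $\Gamma$ is deterministic. $L_U^{ld}(z)$ (resp. $L_U^{la}(z)$) is the minimum number of nodes of a decision tree over $z$ solving $z$ deterministically (resp. nondeterministically). $L_U^{ld}(n)$ and $L_U^{la}(n)$ are the maxima of $L_U^{ld}(z)$ and $L_U^{la}(z)$, respectively, over all problems $z$ over $U$ with $\dim z\le n$. -}

module Defs where

open import Level using (Level; _⊔_) renaming (suc to lsuc)
open import Data.Bool.Base using (Bool)
open import Data.List.Base using (List; []; _∷_; map)
open import Data.List.NonEmpty.Base using (List⁺; _∷_; toList; tail)
open import Data.List.Membership.Propositional using (_∈_)
open import Data.List.Relation.Unary.All using (All)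
open import Data.List.Relation.Unary.Enumerates.Setoid using (IsEnumeration)
open import Data.List.Relation.Unary.Unique.Propositional using (Unique)
open import Data.Nat.Base using (ℕ; suc; _+_; _≤_; NonZero)
open import Data.Product.Base using (Σ; ∃; _×_; _,_; proj₁; proj₂)
open import Data.Refinement.Base using (Refinement-syntax)
open import Data.Unit.Base using (⊤)
open import Data.Vec.Base as Vec using (Vec)
open import Data.Fin.Base using (Fin)
open import Relation.Binary.Bundles using (Setoid)
open import Relation.Binary.PropositionalEquality using (_≡_; _≗_; setoid; _→-setoid_)
import Relation.Binary.Construct.On as On
open import Relation.Nullary.Negation.Core using (¬_)
open import Relation.Unary using (Pred)

private
  variable
    a ℓ : Level

-- Finiteness is taken up to the equivalence of the setoid, so that sets of
-- functions are counted extensionally.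
Infinite : Setoid a ℓ → Set (a ⊔ ℓ)
Infinite S = ¬ ∃ (IsEnumeration S)

IsLeast : Pred ℕ ℓ → Pred ℕ ℓ
IsLeast P m = P m × (∀ k → P k → m ≤ k)

IsGreatest : Pred ℕ ℓ → Pred ℕ ℓ
IsGreatest P m = P m × (∀ k → P k → k ≤ m)

-- The set {1, 2, …}.
ℕ⁺ : Set
ℕ⁺ = [ n ∈ ℕ ∣ NonZero n ]

-- The values 0 and 1 are represented by false and true.
record InfiniteBinarySystem (a ℓ : Level) : Set (lsuc (a ⊔ ℓ)) where
  field
    A : Set a
    F : Pred (A → Bool) ℓ

  Attribute : Set (a ⊔ ℓ)
  Attribute = Σ (A → Bool) F

  value : Attribute → A → Bool
  value = proj₁

  field
    A-infinite : Infinite (setoid A)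
    F-infinite : Infinite (On.setoid (A →-setoid Bool) value)

module _ (U : InfiniteBinarySystem a ℓ) where
  open InfiniteBinarySystem U

  record Problem : Set (a ⊔ ℓ) where
    field
      dim            : ℕ
      .{{dim-nonZero}} : NonZero dim
      ν              : Vec Bool dim → ℕ⁺
      attributes     : Vec Attribute dim

    solution : A → ℕ⁺
    solution x = ν (Vec.map (λ f → value f x) attributes)

  -- What hangs below an edge leaving the root: a working node carries its
  -- attribute and its outgoing edges, each edge paired with the node it enters.
  data Subtree : Set (a ⊔ ℓ) where
    terminal : ℕ⁺ → Subtree
    working  : Attribute → List⁺ (Bool × Subtree) → Subtree

  data DecisionTree : Set (a ⊔ ℓ) where
    root : List⁺ Subtree → DecisionTree

module _ {U : InfiniteBinarySystem a ℓ} where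
  open InfiniteBinarySystem U

  mutual
    nodes : Subtree U → ℕ
    nodes (terminal _)       = 1
    nodes (working _ (e ∷ es)) = 1 + (nodes (proj₂ e) + nodesBelow es)

    nodesBelow : List (Bool × Subtree U) → ℕ
    nodesBelow []             = 0
    nodesBelow ((_ , t) ∷ es) = nodes t + nodesBelow es

  nodesOf : List (Subtree U) → ℕ
  nodesOf []       = 0
  nodesOf (t ∷ ts) = nodes t + nodesOf ts

  L : DecisionTree U → ℕ
  L (root ts) = 1 + nodesOf (toList ts)

  data AllWorking {p} (P : Attribute → List⁺ (Bool × Subtree U) → Set p) :
                  Subtree U → Set (a ⊔ ℓ ⊔ p) where
    terminal : ∀ {c} → AllWorking P (terminal c)
    working  : ∀ {f es} → P f es →
               All (λ e → AllWorking P (proj₂ e)) (toList es) →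
               AllWorking P (working f es)

  data Path : Subtree U → Set (a ⊔ ℓ) where
    end  : ∀ {c} → Path (terminal c)
    step : ∀ {f es δ t} → (δ , t) ∈ toList es → Path t → Path (working f es)

  pathLabel : ∀ {t} → Path t → ℕ⁺
  pathLabel (end {c})  = c
  pathLabel (step _ ξ) = pathLabel ξ

  follows : ∀ {t} → A → Path t → Set
  follows x end                    = ⊤
  follows x (step {f} {δ = δ} _ ξ) = value f x ≡ δ × follows x ξ

  data CompletePath : DecisionTree U → Set (a ⊔ ℓ) where
    start : ∀ {ts t} → t ∈ toList ts → Path t → CompletePath (root ts)

  label : ∀ {Γ} → CompletePath Γ → ℕ⁺
  label (start _ ξ) = pathLabel ξ

  -- x ∈A ξ renders x ∈ A(ξ).
  infix 4 _∈A_
  _∈A_ : ∀ {Γ} → A → CompletePath Γ → Set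
  x ∈A start _ ξ = follows x ξ

  Deterministic : DecisionTree U → Set (a ⊔ ℓ)
  Deterministic (root ts) =
    tail ts ≡ [] ×
    All (AllWorking λ _ es → Unique (map proj₁ (toList es))) (toList ts)

  module _ (z : Problem U) where
    open Problem z

    IsTreeOver : DecisionTree U → Set (a ⊔ ℓ)
    IsTreeOver (root ts) =
      All (AllWorking λ f _ →
             ∃ λ (i : Fin dim) → value f ≗ value (Vec.lookup attributes i))
          (toList ts)

    SolvesNondeterministically : DecisionTree U → Set (a ⊔ ℓ)
    SolvesNondeterministically Γ =
      (∀ x → ∃ λ (ξ : CompletePath Γ) → x ∈A ξ) ×
      (∀ x (ξ : CompletePath Γ) → x ∈A ξ → label ξ ≡ solution x)

    SolvesDeterministically : DecisionTree U → Set (a ⊔ ℓ)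
    SolvesDeterministically Γ =
      Deterministic Γ × SolvesNondeterministically Γ

    -- Minima and maxima over arbitrary sets of problems and trees cannot be
    -- computed constructively, so "the minimum (maximum) is m" is a relation.
    IsLldOf : ℕ → Set (a ⊔ ℓ)
    IsLldOf = IsLeast λ k →
      ∃ λ Γ → IsTreeOver Γ × SolvesDeterministically Γ × L Γ ≡ k

    IsLlaOf : ℕ → Set (a ⊔ ℓ)
    IsLlaOf = IsLeast λ k →
      ∃ λ Γ → IsTreeOver Γ × SolvesNondeterministically Γ × L Γ ≡ k

module _ (U : InfiniteBinarySystem a ℓ) (n : ℕ) where
  open Problem using (dim)

  IsLld : ℕ → Set (a ⊔ ℓ)
  IsLld = IsGreatest λ k → ∃ λ (z : Problem U) → dim z ≤ n × IsLldOf z k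

  IsLla : ℕ → Set (a ⊔ ℓ)
  IsLla = IsGreatest λ k → ∃ λ (z : Problem U) → dim z ≤ n × IsLlaOf z k

-- Let M be the largest number of distinct tuples (f₁(a), …, f_d(a)), a ∈ A,
-- over all choices of d ≤ n attributes; both sides equal 2M.
--
-- Querying only attributes that take both values on the objects still
-- possible gives a deterministic binary tree with one terminal node for each
-- tuple; if there are N tuples, it has 1 + N + (N − 1) = 2N nodes.
--
-- Conversely let ν be injective.  A forest hanging below some edges, reached by
-- the objects of N classes, either resolves all N classes with at least 2N − 1
-- nodes, or resolves at most half as many classes as it has nodes: nondeterminism
-- saves nodes only by giving up some class.  At the root nothing may be given up.
module Submission where

open import Defs
open import Data.Bool.Base using (Bool; true; false; if_then_else_)
open import Data.Bool.Properties using (_≟_; ¬-not)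
open import Data.Empty using (⊥-elim)
open import Data.Fin.Base using (Fin; zero; suc; toℕ; combine)
open import Data.Fin.Properties using (toℕ-injective; combine-injective; 2↔Bool)
open import Data.Irrelevant using ([_])
open import Data.List.Base using (List; []; _∷_; _++_; length; map; filter; allFin)
open import Data.List.Properties using (length-++; length-map; length-tabulate)
open import Data.List.NonEmpty.Base using (_∷_; toList)
open import Data.List.Membership.Propositional using (_∈_)
open import Data.List.Membership.Propositional.Properties
  using (∈-∃++; ∈-++⁺ˡ; ∈-++⁺ʳ; ∈-++⁻; ∈-filter⁺; ∈-filter⁻; ∈-allFin)
open import Data.List.Relation.Binary.Subset.Propositional using (_⊆_)
open import Data.List.Relation.Unary.All as All using (All; []; _∷_)
import Data.List.Relation.Unary.All.Properties as All
open import Data.List.Relation.Unary.AllPairs as AllPairs using (AllPairs; []; _∷_)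
import Data.List.Relation.Unary.AllPairs.Properties as AllPairs
open import Data.List.Relation.Unary.Any using (here; there)
open import Data.List.Relation.Unary.Unique.Propositional using (Unique)
open import Data.Nat.Base
  using (ℕ; zero; suc; _+_; _*_; _^_; _≤_; z≤n; s≤s; NonZero; >-nonZero⁻¹)
open import Data.Nat.Properties
  using (≤-refl; ≤-reflexive; ≤-trans; ≤-antisym; ≤-pred; ≤∧≢⇒<; m≤n+m; m≤m+n; m≤n⇒m≤1+n;
         +-suc; +-identityʳ; +-mono-≤; *-monoʳ-≤; *-distribˡ-+; ^-monoʳ-≤; suc-injective;
         module ≤-Reasoning)
  renaming (_≟_ to _≟ⁿ_; _≤?_ to _≤?ⁿ_)
open import Data.Nat.Tactic.RingSolver using (solve-∀)
open import Data.Product.Base using (∃; _×_; _,_; proj₁; proj₂)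
import Data.Refinement.Base as Refinement
open import Data.Sum.Base using (_⊎_; inj₁; inj₂; [_,_]′)
open import Data.Unit.Base using (⊤; tt)
open import Data.Vec.Base as Vec using (Vec; []; _∷_)
open import Data.Vec.Properties using (∷-injective)
open import Function.Base using (_∘_; _on_)
open import Function.Bundles using (module Inverse)
open import Level using (Level; _⊔_)
open import Relation.Binary.PropositionalEquality
  using (_≡_; _≢_; _≗_; refl; sym; trans; cong; cong₂; subst)
open import Relation.Nullary.Decidable using (yes; no; does; decidable-stable; ¬¬-excluded-middle)
open import Relation.Nullary.Negation using (¬_; contradiction; ¬¬-map)
open import Relation.Unary using (Pred)

private
  variable
    a ℓ p q : Level

-- Preliminaries: duplicate-free lists, bounded maxima, coding of Boolean tuples.

module _ {X : Set a} where

  2*length-++ : ∀ (xs ys : List X) → 2 * length (xs ++ ys) ≡ 2 * length xs + 2 * length ys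
  2*length-++ xs ys =
    trans (cong (2 *_) (length-++ xs)) (*-distribˡ-+ 2 (length xs) (length ys))

  Unique-⊆⇒length≤ : ∀ {xs ys : List X} → Unique xs → xs ⊆ ys → length xs ≤ length ys
  Unique-⊆⇒length≤ [] _ = z≤n
  Unique-⊆⇒length≤ {x ∷ xs} (x∉xs ∷ xs!) xs⊆ys with ∈-∃++ (xs⊆ys (here refl))
  ... | as , bs , refl = ≤-trans (s≤s (Unique-⊆⇒length≤ xs! xs⊆as++bs)) (≤-reflexive length-middle)
    where
    xs⊆as++bs : xs ⊆ as ++ bs
    xs⊆as++bs y∈xs with ∈-++⁻ as (xs⊆ys (there y∈xs))
    ... | inj₁ y∈as         = ∈-++⁺ˡ y∈as
    ... | inj₂ (here refl)  = contradiction refl (All.lookup x∉xs y∈xs)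
    ... | inj₂ (there y∈bs) = ∈-++⁺ʳ as y∈bs

    length-middle : suc (length (as ++ bs)) ≡ length (as ++ x ∷ bs)
    length-middle = trans (cong suc (length-++ as))
      (trans (sym (+-suc (length as) (length bs))) (sym (length-++ as)))

-- Descent on the bound: either `suc b` satisfies `P` and is greatest, or the bound drops to `b`. As
-- `P` is arbitrary, this case distinction is available only under double negation.
¬¬-greatest : (P : Pred ℕ p) (b : ℕ) → (∀ k → P k → k ≤ b) →
              ∀ {k} → P k → ¬ ¬ ∃ (IsGreatest P)
¬¬-greatest P zero    bounded Pk ¬max = ¬max (_ , Pk , λ j Pj → ≤-trans (bounded j Pj) z≤n)
¬¬-greatest P (suc b) bounded Pk ¬max = ¬¬-excluded-middle λ where
    (yes Pb) → ¬max (suc b , Pb , bounded)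
    (no ¬Pb) → ¬¬-greatest P b (λ j Pj → smaller ¬Pb j Pj (bounded j Pj)) Pk ¬max
  where
  smaller : ¬ P (suc b) → ∀ j → P j → j ≤ suc b → j ≤ b
  smaller ¬Pb j Pj j≤1+b with j ≟ⁿ suc b
  ... | yes refl  = contradiction Pj ¬Pb
  ... | no j≢1+b = ≤-pred (≤∧≢⇒< j≤1+b j≢1+b)

encode : ∀ {d} → Vec Bool d → Fin (2 ^ d)
encode []      = zero
encode (b ∷ v) = combine (Inverse.from 2↔Bool b) (encode v)

encode-injective : ∀ {d} (v w : Vec Bool d) → encode v ≡ encode w → v ≡ w
encode-injective []      []      _  = refl
encode-injective (b ∷ v) (c ∷ w) eq
  with combine-injective (Inverse.from 2↔Bool b) (encode v) (Inverse.from 2↔Bool c) (encode w) eq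
... | b≡c , v≡w = cong₂ _∷_ (from-injective b c b≡c) (encode-injective v w v≡w)
  where
  from-injective : ∀ b c → Inverse.from 2↔Bool b ≡ Inverse.from 2↔Bool c → b ≡ c
  from-injective false false _ = refl
  from-injective true  true  _ = refl

-- The hardest choice of ν: distinct tuples receive distinct values, so no terminal node can serve
-- two classes. The `suc` keeps the values positive.
injectiveν : ∀ {d} → Vec Bool d → ℕ⁺
injectiveν v = suc (toℕ (encode v)) Refinement., [ _ ]

injectiveν-injective : ∀ {d} {v w : Vec Bool d} → injectiveν v ≡ injectiveν w → v ≡ w
injectiveν-injective eq =
  encode-injective _ _ (toℕ-injective (suc-injective (cong Refinement.value eq)))

-- Lower bound: classes resolved against nodes spent.

module _ {U : InfiniteBinarySystem a ℓ} where
  open InfiniteBinarySystem U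

  tuple : ∀ {d} → Vec Attribute d → A → Vec Bool d
  tuple gs x = Vec.map (λ g → value g x) gs

  -- Read C as "resolved by a forest of n nodes", B as the objects reaching it.
  Bounds : List A → Pred A p → ℕ → Set (a ⊔ p)
  Bounds B C n = 2 * length B ≤ suc n ⊎
                 ∃ λ I → (∀ {x} → x ∈ B → C x → x ∈ I) × 2 * length I ≤ n

  bounds-∅ : ∀ {B} {C : Pred A p} {n} → (∀ {x} → ¬ C x) → Bounds B C n
  bounds-∅ ∅ = inj₂ ([] , (λ _ Cx → contradiction Cx ∅) , z≤n)

  -- If nothing in `B` is given up, the set `I` of the second alternative contains all of `B`, and
  -- the estimate is even better by one than in the first.
  bounds-all : ∀ {B} {C : Pred A p} {n} → Unique B → (∀ {x} → x ∈ B → C x) →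
               Bounds B C n → 2 * length B ≤ suc n
  bounds-all B! all (inj₁ le)             = le
  bounds-all B! all (inj₂ (I , C⊆I , le)) = ≤-trans
    (*-monoʳ-≤ 2 (Unique-⊆⇒length≤ B! (λ x∈B → C⊆I x∈B (all x∈B))))
    (m≤n⇒m≤1+n le)

  -- Both forests are reached by the same `B`. If one pays for all of `B`, the nodes of the other
  -- are surplus; otherwise the resolved sets are joined, and the estimate without `suc` is
  -- additive.
  bounds-∪ : ∀ {p q r B} {C : Pred A p} {D : Pred A q} {E : Pred A r} {m n} →
             (∀ {x} → E x → C x ⊎ D x) → Bounds B C m → Bounds B D n → Bounds B E (m + n)
  bounds-∪ {m = m} {n} E⊆ (inj₁ le) _         = inj₁ (≤-trans le (s≤s (m≤m+n m n)))
  bounds-∪ {m = m} {n} E⊆ (inj₂ _)  (inj₁ le) = inj₁ (≤-trans le (s≤s (m≤n+m n m)))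
  bounds-∪ E⊆ (inj₂ (I , C⊆I , leI)) (inj₂ (J , D⊆J , leJ)) = inj₂
    ( I ++ J
    , (λ x∈B Ex → [ ∈-++⁺ˡ ∘ C⊆I x∈B , ∈-++⁺ʳ I ∘ D⊆J x∈B ]′ (E⊆ Ex))
    , ≤-trans (≤-reflexive (2*length-++ I J)) (+-mono-≤ leI leJ) )

  -- The extra node is what pays for one side being resolved completely and the
  -- other one not.
  bounds-query : ∀ {p q r B B₀ B₁} {C : Pred A p} {D : Pred A q} {E : Pred A r} {m n} →
                 Unique B → (∀ {x} → x ∈ B → x ∈ B₀ ⊎ x ∈ B₁) →
                 (∀ {x} → x ∈ B → E x → (x ∈ B₀ × C x) ⊎ (x ∈ B₁ × D x)) →
                 Bounds B₀ C m → Bounds B₁ D n → Bounds B E (suc (m + n))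
  bounds-query {B = B} {B₀} {B₁} {E = E} {m} {n} B! B⊆ E⊆ = λ where
      (inj₁ le₀)             (inj₁ le₁)             → inj₁ (begin
        2 * length B                      ≤⟨ *-monoʳ-≤ 2 (Unique-⊆⇒length≤ B!
                                               ([ ∈-++⁺ˡ , ∈-++⁺ʳ B₀ ]′ ∘ B⊆)) ⟩
        2 * length (B₀ ++ B₁)             ≤⟨ sum B₀ B₁ le₀ le₁ ⟩
        suc m + suc n                     ≡⟨ cong suc (+-suc m n) ⟩
        suc (suc (m + n))                 ∎)
      (inj₁ le₀)             (inj₂ (J , D⊆J , leJ)) → inj₂
        (B₀ ++ J , resolved proj₁ (λ (x∈B₁ , Dx) → D⊆J x∈B₁ Dx) , sum B₀ J le₀ leJ)
      (inj₂ (I , C⊆I , leI)) (inj₁ le₁)             → inj₂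
        ( I ++ B₁ , resolved (λ (x∈B₀ , Cx) → C⊆I x∈B₀ Cx) proj₁
        , ≤-trans (sum I B₁ leI le₁) (≤-reflexive (+-suc m n)) )
      (inj₂ (I , C⊆I , leI)) (inj₂ (J , D⊆J , leJ)) → inj₂
        ( I ++ J , resolved (λ (x∈B₀ , Cx) → C⊆I x∈B₀ Cx) (λ (x∈B₁ , Dx) → D⊆J x∈B₁ Dx)
        , m≤n⇒m≤1+n (sum I J leI leJ) )
    where
    open ≤-Reasoning

    sum : ∀ I J {k l} → 2 * length I ≤ k → 2 * length J ≤ l → 2 * length (I ++ J) ≤ k + l
    sum I J leI leJ = ≤-trans (≤-reflexive (2*length-++ I J)) (+-mono-≤ leI leJ)

    resolved : ∀ {I J} → (∀ {x} → x ∈ B₀ × _ → x ∈ I) → (∀ {x} → x ∈ B₁ × _ → x ∈ J) →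
               ∀ {x} → x ∈ B → E x → x ∈ I ++ J
    resolved {I} I⊇ J⊇ x∈B Ex = [ ∈-++⁺ˡ ∘ I⊇ , ∈-++⁺ʳ I ∘ J⊇ ]′ (E⊆ x∈B Ex)

  Edges : Set (a ⊔ ℓ)
  Edges = List (Bool × Subtree U)

  -- Several edges of a node may share a label, so its nodes are divided by label. Edges with the
  -- other label get weight 0 instead of being filtered out, which keeps the recursion over the
  -- edges structural.
  nodesAlong : Bool → Bool × Subtree U → ℕ
  nodesAlong δ (ε , t) = if does (ε ≟ δ) then nodes t else 0

  nodesAlongAll : Bool → Edges → ℕ
  nodesAlongAll δ []       = 0
  nodesAlongAll δ (e ∷ es) = nodesAlong δ e + nodesAlongAll δ es

  nodesAlong-split : ∀ e → nodesAlong false e + nodesAlong true e ≡ nodes (proj₂ e)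
  nodesAlong-split (false , t) = +-identityʳ _
  nodesAlong-split (true  , t) = refl

  +-interchange : ∀ w x y z → (w + x) + (y + z) ≡ (w + y) + (x + z)
  +-interchange = solve-∀

  nodesAlongAll-split : ∀ es → nodesAlongAll false es + nodesAlongAll true es ≡ nodesBelow es
  nodesAlongAll-split []       = refl
  nodesAlongAll-split (e ∷ es) =
    trans (+-interchange (nodesAlong false e) _ _ _)
          (cong₂ _+_ (nodesAlong-split e) (nodesAlongAll-split es))

  Resolves : Subtree U → Pred A (a ⊔ ℓ)
  Resolves t x = ∃ λ (ξ : Path t) → follows x ξ

  ResolvesAlong : Bool → Edges → Pred A (a ⊔ ℓ)
  ResolvesAlong δ es x = ∃ λ t → (δ , t) ∈ es × Resolves t x

  module _ (target : A → ℕ⁺) where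

    Separated : Pred (List A) _
    Separated = AllPairs (_≢_ on target)

    separated⇒unique : ∀ {B} → Separated B → Unique B
    separated⇒unique = AllPairs.map λ ≢ x≡y → ≢ (cong target x≡y)

    Sound : Subtree U → Pred A (a ⊔ ℓ)
    Sound t x = ∀ (ξ : Path t) → follows x ξ → pathLabel ξ ≡ target x

    mutual
      -- A terminal node has one label, so a separated `B` has at most one element there. At a
      -- working node `B` splits into the two fibres of `f`; each fibre is charged to the edges with
      -- its label, and the working node itself is the extra node.
      subtree-bound : ∀ t {B} → Separated B → (∀ {x} → x ∈ B → Sound t x) →
                      Bounds B (Resolves t) (nodes t)
      subtree-bound (terminal c) {[]}         _ _ = inj₁ z≤n
      subtree-bound (terminal c) {x ∷ []}     _ _ = inj₁ ≤-refl
      subtree-bound (terminal c) {x ∷ y ∷ B} ((x≢y ∷ _) ∷ _) sound = contradiction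
        (trans (sym (sound (here refl) end tt)) (sound (there (here refl)) end tt)) x≢y
      subtree-bound (working f (e ∷ es)) {B} B# sound =
        subst (Bounds B _) (cong suc split)
          (bounds-query (separated⇒unique B#) side resolves (along false) (along true))
        where
        module _ (δ : Bool) where
          half : List A
          half = filter (λ x → value f x ≟ δ) B

          soundAlong : ∀ {x} → x ∈ half → ∀ {t} → (δ , t) ∈ e ∷ es → Sound t x
          soundAlong x∈ e∈ ξ fol with ∈-filter⁻ (λ x → value f x ≟ δ) x∈
          ... | x∈B , fx≡δ = sound x∈B (step e∈ ξ) (fx≡δ , fol)

          along : Bounds half (ResolvesAlong δ (e ∷ es)) (nodesAlong δ e + nodesAlongAll δ es)
          along = edges-cons-bound δ e es (AllPairs.filter⁺ _ B#) soundAlong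

        split : (nodesAlong false e + nodesAlongAll false es) +
                (nodesAlong true e + nodesAlongAll true es) ≡ nodes (proj₂ e) + nodesBelow es
        split = nodesAlongAll-split (e ∷ es)

        side′ : ∀ {x} → x ∈ B → ∀ δ → value f x ≡ δ → x ∈ half δ
        side′ x∈B δ = ∈-filter⁺ (λ x → value f x ≟ δ) x∈B

        side : ∀ {x} → x ∈ B → x ∈ half false ⊎ x ∈ half true
        side {x} x∈B with value f x in eq
        ... | false = inj₁ (side′ x∈B false eq)
        ... | true  = inj₂ (side′ x∈B true eq)

        resolves : ∀ {x} → x ∈ B → Resolves (working f (e ∷ es)) x →
                   (x ∈ half false × ResolvesAlong false (e ∷ es) x) ⊎
                   (x ∈ half true × ResolvesAlong true (e ∷ es) x)
        resolves x∈B (step {δ = false} e∈ ξ , fx , fol) =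
          inj₁ (side′ x∈B false fx , _ , e∈ , ξ , fol)
        resolves x∈B (step {δ = true} e∈ ξ , fx , fol) =
          inj₂ (side′ x∈B true fx , _ , e∈ , ξ , fol)

      edges-bound : ∀ δ es {B} → Separated B →
                    (∀ {x} → x ∈ B → ∀ {t} → (δ , t) ∈ es → Sound t x) →
                    Bounds B (ResolvesAlong δ es) (nodesAlongAll δ es)
      edges-bound δ []       B# sound = bounds-∅ λ { (_ , () , _) }
      edges-bound δ (e ∷ es) B# sound = edges-cons-bound δ e es B# sound

      -- Head and tail are separate arguments because the list `e ∷ es` is not a subterm of the
      -- `List⁺` in a working node, while `e` and `es` are.
      edges-cons-bound : ∀ δ e es {B} → Separated B →
                         (∀ {x} → x ∈ B → ∀ {t} → (δ , t) ∈ e ∷ es → Sound t x) →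
                         Bounds B (ResolvesAlong δ (e ∷ es)) (nodesAlong δ e + nodesAlongAll δ es)
      edges-cons-bound δ (ε , t) es B# sound = bounds-∪
        (λ { (_ , here refl , r) → inj₁ (refl , r) ; (_ , there e∈ , r) → inj₂ (_ , e∈ , r) })
        (edge-bound δ ε t B# λ { x∈B refl → sound x∈B (here refl) })
        (edges-bound δ es B# λ x∈B e∈ → sound x∈B (there e∈))

      edge-bound : ∀ δ ε t {B} → Separated B → (∀ {x} → x ∈ B → ε ≡ δ → Sound t x) →
                   Bounds B (λ x → ε ≡ δ × Resolves t x) (nodesAlong δ (ε , t))
      -- The decision also evaluates `nodesAlong`: 0 for an edge that resolves nothing here,
      -- `nodes t` otherwise.
      edge-bound δ ε t B# sound with ε ≟ δ
      ... | no ε≢δ   = bounds-∅ (ε≢δ ∘ proj₁)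
      ... | yes refl with subtree-bound t B# (λ x∈B → sound x∈B refl)
      ...   | inj₁ le             = inj₁ le
      ...   | inj₂ (I , R⊆I , le) = inj₂ (I , (λ x∈B → R⊆I x∈B ∘ proj₂) , le)

    forest-bound : ∀ ts {B} → Separated B → (∀ {x} → x ∈ B → ∀ {t} → t ∈ ts → Sound t x) →
                   Bounds B (λ x → ∃ λ t → t ∈ ts × Resolves t x) (nodesOf ts)
    forest-bound []       B# sound = bounds-∅ λ { (_ , () , _) }
    forest-bound (t ∷ ts) B# sound = bounds-∪
      (λ { (_ , here refl , r) → inj₁ r ; (_ , there t∈ , r) → inj₂ (_ , t∈ , r) })
      (subtree-bound t B# λ x∈B → sound x∈B (here refl))
      (forest-bound ts B# λ x∈B t∈ → sound x∈B (there t∈))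

  -- Edges leaving the root are unlabeled, so every object reaches every subtree. Completeness rules
  -- out giving up a class, and the `suc` of `bounds-all` is the root.
  nondeterministic⇒2*length≤L : ∀ z {B} → AllPairs (_≢_ on Problem.solution z) B →
                                ∀ Γ → SolvesNondeterministically z Γ → 2 * length B ≤ L Γ
  nondeterministic⇒2*length≤L z B# (root ts) (complete , sound) = bounds-all
    (separated⇒unique solution B#)
    (λ {x} _ → case-start (complete x))
    (forest-bound solution (toList ts) B# λ {x} _ t∈ ξ → sound x (start t∈ ξ))
    where
    open Problem z
    case-start : ∀ {x} → (∃ λ (ξ : CompletePath (root ts)) → x ∈A ξ) →
                 ∃ λ t → t ∈ toList ts × Resolves t x
    case-start (start t∈ ξ , fol) = _ , t∈ , ξ , fol

  -- Upper bound: deterministic trees without wasted queries.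

  module _ (target : A → ℕ⁺) (Allowed : Pred Attribute p) where

    -- `B` holds the objects compatible with the answers so far, `gs` the attributes still to be
    -- considered. In `size` the future root is counted in advance, which makes sizes add up exactly
    -- in `query`.
    record OptimalTree {d} (gs : Vec Attribute d) (B : A → Set) : Set (a ⊔ ℓ ⊔ p) where
      field
        tree          : Subtree U
        classes       : List A
        classes⊆B     : All B classes
        distinct      : AllPairs (_≢_ on tuple gs) classes
        size          : suc (nodes tree) ≡ 2 * length classes
        deterministic : AllWorking (λ _ es → Unique (map proj₁ (toList es))) tree
        allowed       : AllWorking (λ f _ → Allowed f) tree
        complete      : ∀ {x} → B x → Resolves tree x
        sound         : ∀ {x} → B x → Sound target tree x
    open OptimalTree

    module _ {d : ℕ} {gs : Vec Attribute d} {f : Attribute} {B : A → Set} where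

      Fibre : Bool → A → Set
      Fibre b x = B x × value f x ≡ b

      -- An attribute constant on `B` separates nothing, so the tree of the only fibre is reused
      -- without a new node.
      skip : ∀ {b} → (∀ {x} → B x → value f x ≡ b) →
             OptimalTree gs (Fibre b) → OptimalTree (f ∷ gs) B
      skip const T = record
        { tree          = tree T
        ; classes       = classes T
        ; classes⊆B     = All.map proj₁ (classes⊆B T)
        ; distinct      = AllPairs.map (λ ≢ eq → ≢ (proj₂ (∷-injective eq))) (distinct T)
        ; size          = size T
        ; deterministic = deterministic T
        ; allowed       = allowed T
        ; complete      = λ x∈B → complete T (x∈B , const x∈B)
        ; sound         = λ x∈B → sound T (x∈B , const x∈B)
        }

      -- Representatives from different fibres differ in the first entry of their tuples, so the
      -- lists of classes concatenate. The new working node replaces one of the two roots counted in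
      -- advance.
      query : Allowed f → OptimalTree gs (Fibre false) → OptimalTree gs (Fibre true) →
              OptimalTree (f ∷ gs) B
      query allowed-f T₀ T₁ = record
        { tree          = working f ((false , tree T₀) ∷ (true , tree T₁) ∷ [])
        ; classes       = classes T₀ ++ classes T₁
        ; classes⊆B     = All.++⁺ (All.map proj₁ (classes⊆B T₀)) (All.map proj₁ (classes⊆B T₁))
        ; distinct      = AllPairs.++⁺ (weaken T₀) (weaken T₁)
            (All.map (λ (_ , fx) → All.map (λ (_ , fy) eq →
              contradiction (trans (sym fx) (trans (proj₁ (∷-injective eq)) fy)) λ ())
              (classes⊆B T₁)) (classes⊆B T₀))
        ; size          = trans (rearrange (nodes (tree T₀)) (nodes (tree T₁)))
            (trans (cong₂ _+_ (size T₀) (size T₁)) (sym (2*length-++ (classes T₀) (classes T₁))))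
        ; deterministic = working (((λ ()) ∷ []) ∷ [] ∷ []) (deterministic T₀ ∷ deterministic T₁ ∷ [])
        ; allowed       = working allowed-f (allowed T₀ ∷ allowed T₁ ∷ [])
        ; complete      = complete′
        ; sound         = λ where
            x∈B (step (here refl) ξ) (fx , fol)         → sound T₀ (x∈B , fx) ξ fol
            x∈B (step (there (here refl)) ξ) (fx , fol) → sound T₁ (x∈B , fx) ξ fol
        }
        where
        weaken : ∀ {b} (T : OptimalTree gs (Fibre b)) → AllPairs (_≢_ on tuple (f ∷ gs)) (classes T)
        weaken T = AllPairs.map (λ ≢ eq → ≢ (proj₂ (∷-injective eq))) (distinct T)

        rearrange : ∀ m n → suc (suc (m + (n + 0))) ≡ suc m + suc n
        rearrange = solve-∀

        complete′ : ∀ {x} → B x → Resolves _ x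
        complete′ {x} x∈B with value f x in fx
        ... | false = let ξ , fol = complete T₀ (x∈B , fx) in step (here refl) ξ , fx , fol
        ... | true  = let ξ , fol = complete T₁ (x∈B , fx) in step (there (here refl)) ξ , fx , fol

    -- Each attribute is queried exactly when it takes both values on `B`, which keeps every fibre
    -- in use inhabited; deciding this causes the double negation. Once `gs` is exhausted, `target`
    -- is constant on `B`, and the given object supplies the label.
    optimalTree : ∀ {d} (gs : Vec Attribute d) {B : A → Set} {x} → B x →
                  (∀ i → Allowed (Vec.lookup gs i)) →
                  (∀ {x y} → B x → B y → tuple gs x ≡ tuple gs y → target x ≡ target y) →
                  ¬ ¬ OptimalTree gs B
    optimalTree [] {x = x} x∈B _ determined ¬T = ¬T record
      { tree          = terminal (target x)
      ; classes       = x ∷ []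
      ; classes⊆B     = x∈B ∷ []
      ; distinct      = [] ∷ []
      ; size          = refl
      ; deterministic = terminal
      ; allowed       = terminal
      ; complete      = λ _ → end , tt
      ; sound         = λ { y∈B end _ → determined x∈B y∈B refl }
      }
    optimalTree (f ∷ gs) {B} {x} x∈B allowed-gs determined ¬T =
      ¬¬-excluded-middle λ where
        (no ∄false) → fibre true x (x∈B , ¬-not (λ fx → ∄false (x , x∈B , fx)))
          λ T → ¬T (skip (λ {y} y∈B → ¬-not (λ fy → ∄false (y , y∈B , fy))) T)
        (yes (x₀ , x₀∈)) → ¬¬-excluded-middle λ where
          (no ∄true) → fibre false x₀ x₀∈
            λ T → ¬T (skip (λ {y} y∈B → ¬-not (λ fy → ∄true (y , y∈B , fy))) T)
          (yes (x₁ , x₁∈)) →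
            fibre false x₀ x₀∈ λ T₀ → fibre true x₁ x₁∈ λ T₁ → ¬T (query (allowed-gs zero) T₀ T₁)
      where
      fibre : ∀ b y → B y × value f y ≡ b → ¬ ¬ OptimalTree gs (λ y → B y × value f y ≡ b)
      fibre b y y∈ = optimalTree gs y∈ (allowed-gs ∘ suc) λ (y∈B , fy) (z∈B , fz) eq →
        determined y∈B z∈B (cong₂ _∷_ (trans fy (sym fz)) eq)

  Distinguishes : Problem U → Pred (List A) a
  Distinguishes z = AllPairs (_≢_ on tuple (Problem.attributes z))

  deterministicTree : ∀ z → ¬ ¬ (∃ λ Γ → IsTreeOver z Γ × SolvesDeterministically z Γ ×
                                         ∃ λ B → Distinguishes z B × L Γ ≡ 2 * length B)
  -- An object is needed to start. If every object led to a contradiction, the empty list would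
  -- enumerate `A`.
  deterministicTree z ¬Γ = A-infinite ([] , λ x → ⊥-elim
    (optimalTree solution (λ f → ∃ λ i → value f ≗ value (Vec.lookup attributes i))
      attributes {B = λ _ → ⊤} {x = x} tt (λ i → i , λ _ → refl) (λ _ _ → cong ν)
      (¬Γ ∘ build)))
    where
    open Problem z
    open OptimalTree
    build : OptimalTree solution _ attributes (λ _ → ⊤) → _
    build T = root (tree T ∷ [])
      , allowed T ∷ []
      , ( (refl , deterministic T ∷ [])
        , (λ x → let ξ , fol = complete T {x} tt in start (here refl) ξ , fol)
        , λ { x (start (here refl) ξ) → sound T tt ξ } )
      , classes T , distinct T , trans (cong suc (+-identityʳ _)) (size T)

  Distinguishes⇒length≤ : ∀ z {B} → Distinguishes z B → length B ≤ 2 ^ Problem.dim z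
  Distinguishes⇒length≤ z {B} B# = begin
    length B                      ≡⟨ length-map code B ⟨
    length (map code B)           ≤⟨ Unique-⊆⇒length≤ code-unique (λ _ → ∈-allFin _) ⟩
    length (allFin (2 ^ dim))     ≡⟨ length-tabulate _ ⟩
    2 ^ dim                       ∎
    where
    open Problem z
    open ≤-Reasoning
    code : A → Fin (2 ^ dim)
    code = encode ∘ tuple attributes
    code-unique : Unique (map code B)
    code-unique = AllPairs.map⁺ (AllPairs.map (λ ≢ → ≢ ∘ encode-injective _ _) B#)

  withInjectiveν : Problem U → Problem U
  withInjectiveν z = record z { ν = injectiveν }

-- Maxima over the problems of dimension at most `n`.

module _ (U : InfiniteBinarySystem a ℓ) (n : ℕ) .{{_ : NonZero n}} where
  open InfiniteBinarySystem U
  open Problem using (dim)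

  -- Any list of pairwise distinguished objects counts, not only a full system of representatives;
  -- the greatest value is the same.
  ClassCount : Pred ℕ (a ⊔ ℓ)
  ClassCount k = ∃ λ (z : Problem U) → dim z ≤ n × ∃ λ B → Distinguishes z B × length B ≡ k

  greatestClassCount : ¬ ¬ ∃ (IsGreatest ClassCount)
  -- One attribute already yields a problem of dimension 1; without any, the empty list would
  -- enumerate `F`.
  greatestClassCount ¬max = F-infinite ([] , λ f → ⊥-elim
    (¬¬-greatest ClassCount (2 ^ n) bounded (trivial f) ¬max))
    where
    bounded : ∀ k → ClassCount k → k ≤ 2 ^ n
    bounded _ (z , d≤n , B , B# , refl) =
      ≤-trans (Distinguishes⇒length≤ z B#) (^-monoʳ-≤ 2 d≤n)

    trivial : Attribute → ClassCount 0
    trivial f = record { dim = 1 ; ν = injectiveν ; attributes = f ∷ [] }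
              , >-nonZero⁻¹ n , [] , [] , refl

  module _ (z : Problem U) (d≤n : dim z ≤ n) {B : List A} (B# : Distinguishes z B)
           (maximal : ∀ k → ClassCount k → k ≤ length B) where

    M : ℕ
    M = length B

    deterministic≤2M : ∀ z → dim z ≤ n →
      ¬ ¬ (∃ λ Γ → IsTreeOver z Γ × SolvesDeterministically z Γ × L Γ ≤ 2 * M)
    deterministic≤2M z d≤n = ¬¬-map
      (λ (Γ , over , solves , B , B# , L≡) →
        Γ , over , solves ,
        ≤-trans (≤-reflexive L≡) (*-monoʳ-≤ 2 (maximal _ (z , d≤n , B , B# , refl))))
      (deterministicTree z)

    stable-≤ : ∀ {k l} → ¬ ¬ (k ≤ l) → k ≤ l
    stable-≤ = decidable-stable (_ ≤?ⁿ _)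

    z* : Problem U
    z* = withInjectiveν z

    2M≤nondeterministic : ∀ Γ → SolvesNondeterministically z* Γ → 2 * M ≤ L Γ
    2M≤nondeterministic =
      nondeterministic⇒2*length≤L z* (AllPairs.map (λ ≢ → ≢ ∘ injectiveν-injective) B#)

    -- A single deterministic tree settles both minima: it has at most `2 * M` nodes, and even
    -- nondeterministic trees for `z*` have no fewer.
    2M-attained : ¬ ¬ (IsLlaOf z* (2 * M) × IsLldOf z* (2 * M))
    2M-attained = ¬¬-map
      (λ (Γ , over , solves@(_ , nsolves) , L≤) →
        let L≡ = ≤-antisym L≤ (2M≤nondeterministic Γ nsolves) in
        ( (Γ , over , nsolves , L≡)
        , λ { _ (Γ′ , _ , nsolves′ , refl) → 2M≤nondeterministic Γ′ nsolves′ } )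
        ,
        ( (Γ , over , solves , L≡)
        , λ { _ (Γ′ , _ , (_ , nsolves′) , refl) → 2M≤nondeterministic Γ′ nsolves′ } ))
      (deterministic≤2M z* d≤n)

    2M-greatest : ¬ ¬ (IsLla U n (2 * M) × IsLld U n (2 * M))
    2M-greatest = ¬¬-map
      (λ (la , ld) →
        ( (z* , d≤n , la)
        -- The deterministic tree also competes in the nondeterministic minimum. The tree exists
        -- only under double negation, but the inequality is decidable.
        , λ k (z , d≤n , _ , least) → stable-≤ (¬¬-map
            (λ (Γ , over , (_ , solves) , L≤) → ≤-trans (least _ (Γ , over , solves , refl)) L≤)
            (deterministic≤2M z d≤n)) )
        ,
        ( (z* , d≤n , ld)
        , λ k (z , d≤n , _ , least) → stable-≤ (¬¬-map
            (λ (Γ , over , solves , L≤) → ≤-trans (least _ (Γ , over , solves , refl)) L≤)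
            (deterministic≤2M z d≤n)) ))
      2M-attained

IsGreatest-unique : ∀ {P : Pred ℕ p} {m n} → IsGreatest P m → IsGreatest P n → m ≡ n
IsGreatest-unique (Pm , m-max) (Pn , n-max) = ≤-antisym (n-max _ Pm) (m-max _ Pn)

proposition4 : ∀ {a ℓ} (U : InfiniteBinarySystem a ℓ) (n : ℕ) → .{{_ : NonZero n}} →
    (∀ p q → IsLla U n p → IsLld U n q → p ≡ q) ×
    ¬ ¬ (∃ λ m → IsLla U n m × IsLld U n m)
proposition4 U n = unique , exists
  where
  exists : ¬ ¬ (∃ λ m → IsLla U n m × IsLld U n m)
  exists ¬m = greatestClassCount U n λ where
    (_ , (z , d≤n , _ , B# , refl) , maximal) →
      2M-greatest U n z d≤n B# maximal λ both → ¬m (_ , both)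

  unique : ∀ p q → IsLla U n p → IsLld U n q → p ≡ q
  -- Both numbers are compared with the common maximum; equality of naturals is decidable, so its
  -- existence under double negation suffices.
  unique p q la ld = decidable-stable (p ≟ⁿ q) (¬¬-map
    (λ (_ , la′ , ld′) → trans (IsGreatest-unique la la′) (IsGreatest-unique ld′ ld))
    exists)
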